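{- Let $T$ be a tree with $n\geq 2$ vertices. Let $k$ and $i$ be nonnegative integers with $0\leq i\leq 2k$ and $n=k^2+i$. For any $v\in C(T)$, \[\frac{\operatorname{Ecc}(T)}{\operatorname{ecc}_T(v)} \geq \begin{cases} n-3+2k+\frac{i}{k} & \text{if } 0\leq i\leq k,\\ n-3+2k+\frac{i+1}{k+1} & \text{if } k+1\leq i\leq 2k.\end{cases}\] For $n\geq 4$, equality holds if and only if $T$ is a tree whose longest path has $2x$ vertices, where $x=k$ in the first case and $x=k+1$ in the second case, and every vertex not on this path is adjacent to one of the two center vertices of this path. For $i=k$ the two bounds agree and both values of $x$ give an extremal tree.
   Context: For a vertex $v$ of a tree $T$, $\operatorname{ecc}_T(v)=\max_{u\in V(T)} d_T(u,v)$. The total eccentricity is $\operatorname{Ecc}(T)=\sum_{z\in V(T)}\operatorname{ecc}_T(z)$. The center $C(T)$ is the set of vertices of minimum eccentricity. -}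

module Defs where

open import Data.Nat using (ℕ; zero; suc; _+_; _*_; _∸_; _≤_; _⊔_)
open import Data.Fin using (Fin)
open import Data.Bool using (Bool; true; false)
open import Data.List using (List; []; _∷_; _++_; _∷ʳ_; length; map; foldr; allFin)
open import Data.Nat.ListAction using (sum)
open import Data.List.Relation.Unary.Linked using (Linked)
open import Data.List.Relation.Unary.Unique.Propositional using (Unique)
open import Data.List.Membership.Propositional using (_∉_)
open import Data.Product using (Σ; ∃; _×_)
open import Data.Sum using (_⊎_)
open import Data.Empty using (⊥)
open import Relation.Binary.PropositionalEquality using (_≡_)

record Graph (n : ℕ) : Set where
  field
    E     : Fin n → Fin n → Bool
    sym   : ∀ u v → E u v ≡ E v u
    loopless : ∀ u → E u u ≡ false

module _ {n : ℕ} (G : Graph n) where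
  open Graph G

  Adj : Fin n → Fin n → Set
  Adj u v = E u v ≡ true

  data Walk : Fin n → Fin n → ℕ → Set where
    here : ∀ {u} → Walk u u 0
    step : ∀ {u w v m} → Adj u w → Walk w v m → Walk u v (suc m)

  Connected : Set
  Connected = ∀ u v → ∃ λ m → Walk u v m

  IsPath : List (Fin n) → Set
  IsPath P = Unique P × Linked Adj P

  IsCycle : Fin n → List (Fin n) → Set
  IsCycle v xs = 2 ≤ length xs × Unique (v ∷ xs) × Linked Adj ((v ∷ xs) ∷ʳ v)

  Acyclic : Set
  Acyclic = ∀ v xs → IsCycle v xs → ⊥

  IsTree : Set
  IsTree = Connected × Acyclic

  IsDistance : (Fin n → Fin n → ℕ) → Set
  IsDistance d = ∀ u v → Walk u v (d u v) × (∀ m → Walk u v m → d u v ≤ m)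

  -- Extremal tree shape with parameter x: some longest path has 2x vertices
  -- A ++ a ∷ b ∷ B (a, b its two center vertices), and every vertex not on
  -- this path is adjacent to a or b.
  Extremal : ℕ → Set
  Extremal x =
    Σ (List (Fin n)) λ A → Σ (Fin n) λ a → Σ (Fin n) λ b → Σ (List (Fin n)) λ B →
      suc (length A) ≡ x × length B ≡ length A
      × IsPath (A ++ a ∷ b ∷ B)
      × (∀ Q → IsPath Q → length Q ≤ length (A ++ a ∷ b ∷ B))
      × (∀ w → w ∉ A ++ a ∷ b ∷ B → Adj w a ⊎ Adj w b)

ecc : {n : ℕ} → (Fin n → Fin n → ℕ) → Fin n → ℕ
ecc {n} d v = foldr _⊔_ 0 (map (λ u → d u v) (allFin n))

Ecc : {n : ℕ} → (Fin n → Fin n → ℕ) → ℕ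
Ecc {n} d = sum (map (ecc d) (allFin n))

InCenter : {n : ℕ} → (Fin n → Fin n → ℕ) → Fin n → Set
InCenter {n} d v = ∀ (u : Fin n) → ecc d v ≤ ecc d u

AllowedX : ℕ → ℕ → ℕ → Set
AllowedX k i x = (x ≡ k × i ≤ k) ⊎ (x ≡ suc k × k ≤ i)

{-# OPTIONS --safe #-}
module Submission where

-- Every edge of a tree is a bridge, so distances between its two sides add up. Let b be a central vertex, r its
-- eccentricity, p a vertex at distance r from b, and a the neighbour of b towards p. As ecc a ≥ r, some q on the
-- side of b has d b q ≥ r − 1. The geodesic from p through a, b towards q gives 2r vertices of eccentricities at
-- least r, r, r + 1, r + 1, …, 2r − 1, 2r − 1, and a vertex w off it has eccentricity at least r + d w {a, b}.
-- Hence Ecc + 3r ≥ r² + n r + n, with equality only if all other vertices hang off a or b, and it remains to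
-- minimise r + n / r over the integers. Conversely, in such a tree the eccentricities are bounded from above by the
-- same numbers, and r = x because simple paths in a tree are geodesics.

open import Defs
open import Data.Nat using (ℕ; zero; suc; _+_; _*_; _∸_; _≤_; _<_; _⊔_; z≤n; s≤s; s≤s⁻¹)
open import Data.Nat.Properties
open import Data.Nat.ListAction using (sum)
open import Data.Nat.ListAction.Properties using (sum-++; sum-↭)
open import Data.Nat.Tactic.RingSolver using (solve-∀)
open import Data.Fin using (Fin; zero; suc)
import Data.Fin.Properties as Fin
open import Data.List using (List; []; _∷_; _++_; _∷ʳ_; length; map; foldr; allFin; filter)
open import Data.List.Properties using (length-++; length-tabulate; map-++)
open import Data.List.Relation.Unary.Linked using (Linked; []; [-]; _∷_)
open import Data.List.Relation.Unary.Any using (here; there)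
open import Data.List.Relation.Unary.All as All using (All; []; _∷_)
open import Data.List.Relation.Unary.All.Properties using (¬Any⇒All¬; All¬⇒¬Any)
open import Data.List.Relation.Unary.AllPairs using ([]; _∷_)
open import Data.List.Relation.Unary.Unique.Propositional using (Unique)
import Data.List.Relation.Unary.Unique.Propositional.Properties as Unique
open import Data.List.Membership.Propositional using (_∈_; _∉_)
open import Data.List.Membership.Propositional.Properties using (∈-allFin; ∈-filter⁺; ∈-filter⁻; ∈-++⁺ˡ; ∈-++⁺ʳ; ∈-++⁻)
open import Data.List.Membership.Propositional.Properties.WithK using (unique∧set⇒bag)
open import Data.List.Relation.Binary.BagAndSetEquality using (∼bag⇒↭)
open import Data.List.Relation.Binary.Permutation.Propositional using (_↭_)
open import Data.List.Relation.Binary.Permutation.Propositional.Properties using (↭-length; map⁺)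
open import Data.Product using (∃; _×_; _,_; proj₁; proj₂)
open import Data.Sum using (_⊎_; inj₁; inj₂; [_,_]′)
open import Data.Empty using (⊥-elim)
open import Function using (_∘_)
open import Function.Bundles using (_⇔_; mk⇔)
open import Relation.Nullary using (¬_; yes; no; contradiction)
open import Relation.Binary.PropositionalEquality using (_≡_; _≢_; refl; sym; trans; cong; cong₂; subst; module ≡-Reasoning)
open import Relation.Binary.Construct.Closure.ReflexiveTransitive using (Star; ε; _◅_; _◅◅_; reverse)

module _ {n : ℕ} where
  open import Data.List.Membership.DecPropositional (Fin._≟_ {n}) using (_∈?_; _∉?_) public

-- Simple paths

-- The relation is a parameter because paths are needed both for adjacency and for adjacency without
-- one edge.
data SimplePath {V : Set} (R : V → V → Set) : V → V → List V → Set where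
  stop : ∀ {u} → SimplePath R u u (u ∷ [])
  cons : ∀ {u w v l} → R u w → u ∉ l → SimplePath R w v l → SimplePath R u v (u ∷ l)

module _ {V : Set} {R : V → V → Set} where

  head∈ : ∀ {u v l} → SimplePath R u v l → u ∈ l
  head∈ stop         = here refl
  head∈ (cons _ _ _) = here refl

  suffix : ∀ {u w v l} → SimplePath R w v l → u ∈ l → ∃ (SimplePath R u v)
  suffix P            (here refl) with P
  ... | stop          = _ , stop
  ... | cons r w∉ P′  = _ , cons r w∉ P′
  suffix (cons _ _ P) (there u∈)  = suffix P u∈

  simple⇒unique : ∀ {u v l} → SimplePath R u v l → Unique l
  simple⇒unique stop           = [] ∷ []
  simple⇒unique (cons _ u∉l P) = ¬Any⇒All¬ _ u∉l ∷ simple⇒unique P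

  -- In use, `z` is the start of the path, so that the edge `vz` closes a cycle; `R⇒S` forgets that
  -- the path avoided an edge.
  simple⇒linked : ∀ {S : V → V → Set} {u v z l} → (∀ {x y} → R x y → S x y) →
                  SimplePath R u v l → S v z → Linked S (l ∷ʳ z)
  simple⇒linked R⇒S stop                    vz = vz ∷ [-]
  simple⇒linked R⇒S (cons r _ stop)         vz = R⇒S r ∷ vz ∷ [-]
  simple⇒linked R⇒S (cons r _ P@(cons _ _ _)) vz = R⇒S r ∷ simple⇒linked R⇒S P vz

  unique∧linked⇒simple : ∀ {x xs} → Unique (x ∷ xs) → Linked R (x ∷ xs) →
                         ∃ λ y → SimplePath R x y (x ∷ xs)
  unique∧linked⇒simple _         [-]     = _ , stop
  unique∧linked⇒simple (x∉ ∷ un) (r ∷ L) with unique∧linked⇒simple un L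
  ... | y , P = y , cons r (All¬⇒¬Any x∉) P

-- If the new start already occurs on the shortened rest, keeping only the part from that occurrence
-- cuts the loop out.
loop-erase : ∀ {n} {R : Fin n → Fin n → Set} {u v} → Star R u v → ∃ (SimplePath R u v)
loop-erase ε = _ , stop
loop-erase {u = u} (r ◅ W) with loop-erase W
... | l , P with u ∈? l
...   | yes u∈l = suffix P u∈l
...   | no  u∉l = _ , cons r u∉l P

-- Sums over lists of vertices

Σ[_] : {V : Set} → List V → (V → ℕ) → ℕ
Σ[ l ] f = sum (map f l)

Σ-++ : {V : Set} (f : V → ℕ) (xs ys : List V) → Σ[ xs ++ ys ] f ≡ Σ[ xs ] f + Σ[ ys ] f
Σ-++ f xs ys = trans (cong sum (map-++ f xs ys)) (sum-++ (map f xs) (map f ys))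

Σ-lower : {V : Set} {f : V → ℕ} {t : ℕ} {xs : List V} → All (λ x → t ≤ f x) xs → length xs * t ≤ Σ[ xs ] f
Σ-lower []       = z≤n
Σ-lower (p ∷ ps) = +-mono-≤ p (Σ-lower ps)

Σ-upper : {V : Set} {f : V → ℕ} {t : ℕ} {xs : List V} → All (λ x → f x ≤ t) xs → Σ[ xs ] f ≤ length xs * t
Σ-upper []       = z≤n
Σ-upper (p ∷ ps) = +-mono-≤ p (Σ-upper ps)

-- Subtracting the lower bounds of all other terms leaves no slack for any single term.
Σ-tight : {V : Set} {f : V → ℕ} {t : ℕ} {xs : List V} → All (λ x → t ≤ f x) xs →
          Σ[ xs ] f ≤ length xs * t → All (λ x → f x ≤ t) xs
Σ-tight []       _ = []
Σ-tight {f = f} {t} {x ∷ xs} (p ∷ ps) q =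
  +-cancelʳ-≤ (length xs * t) (f x) t (≤-trans (+-monoʳ-≤ (f x) (Σ-lower ps)) q)
  ∷ Σ-tight ps (+-cancelˡ-≤ t (Σ[ xs ] f) (length xs * t) (≤-trans (+-monoˡ-≤ (Σ[ xs ] f) p) q))

off : ∀ {n} → List (Fin n) → List (Fin n)
off {n} P = filter (_∉? P) (allFin n)

∈off⁺ : ∀ {n} {P : List (Fin n)} {w} → w ∉ P → w ∈ off P
∈off⁺ {P = P} {w} w∉P = ∈-filter⁺ (_∉? P) (∈-allFin w) w∉P

∈off⁻ : ∀ {n} {P : List (Fin n)} {w} → w ∈ off P → w ∉ P
∈off⁻ {n} {P} w∈ = proj₂ (∈-filter⁻ (_∉? P) {xs = allFin n} w∈)

allFin↭ : ∀ {n} {P : List (Fin n)} → Unique P → allFin n ↭ P ++ off P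
allFin↭ {n} {P} uP = ∼bag⇒↭ (unique∧set⇒bag (Unique.allFin⁺ n)
  (Unique.++⁺ uP (Unique.filter⁺ (_∉? P) (Unique.allFin⁺ n)) λ { (x∈P , x∈off) → ∈off⁻ x∈off x∈P })
  (mk⇔ (λ _ → covered) (λ _ → ∈-allFin _)))
  where
  covered : ∀ {w} → w ∈ P ++ off P
  covered {w} with w ∈? P
  ... | yes w∈P = ∈-++⁺ˡ w∈P
  ... | no  w∉P = ∈-++⁺ʳ P (∈off⁺ w∉P)

-- The sum (j + 1) + ... + (j + m), the shape of the eccentricities along one half of the extremal
-- path.
rise : ℕ → ℕ → ℕ
rise j zero    = 0
rise j (suc m) = (j + suc m) + rise j m

-- The recursion of `rise` removes the largest term, which fits the half listed towards the middle.
-- For the half listed away from the middle the smallest term has to come off first.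
rise-head : ∀ j m → rise j (suc m) ≡ suc j + rise (suc j) m
rise-head j zero    = cong (_+ 0) (+-comm j 1)
rise-head j (suc m) = begin
  (j + suc (suc m)) + rise j (suc m)          ≡⟨ cong ((j + suc (suc m)) +_) (rise-head j m) ⟩
  (j + suc (suc m)) + (suc j + rise (suc j) m) ≡⟨ lemma j m (rise (suc j) m) ⟩
  suc j + ((suc j + suc m) + rise (suc j) m)  ∎
  where
  open ≡-Reasoning
  lemma : ∀ j m x → (j + suc (suc m)) + (suc j + x) ≡ suc j + ((suc j + suc m) + x)
  lemma = solve-∀

rise-double : ∀ j m → 2 * rise j m ≡ m * (2 * j + suc m)
rise-double j zero    = refl
rise-double j (suc m) = begin
  2 * ((j + suc m) + rise j m)               ≡⟨ *-distribˡ-+ 2 (j + suc m) (rise j m) ⟩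
  2 * (j + suc m) + 2 * rise j m             ≡⟨ cong (2 * (j + suc m) +_) (rise-double j m) ⟩
  2 * (j + suc m) + m * (2 * j + suc m)      ≡⟨ lemma j m ⟩
  suc m * (2 * j + suc (suc m))              ∎
  where
  open ≡-Reasoning
  lemma : ∀ j m → 2 * (j + suc m) + m * (2 * j + suc m) ≡ suc m * (2 * j + suc (suc m))
  lemma = solve-∀

-- The value of Ecc on the extremal tree of radius s + 1 with c vertices off its longest path.
bound : ℕ → ℕ → ℕ
bound s c = (rise (suc s) s + (suc s + (suc s + rise (suc s) s))) + c * suc (suc s)

-- Distances and eccentricities

foldr-⊔-upper : {V : Set} (f : V → ℕ) {x : V} {xs : List V} → x ∈ xs → f x ≤ foldr _⊔_ 0 (map f xs)
foldr-⊔-upper f (here refl) = m≤m⊔n _ _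
foldr-⊔-upper f (there x∈)  = ≤-trans (foldr-⊔-upper f x∈) (m≤n⊔m _ _)

foldr-⊔-least : {V : Set} (f : V → ℕ) {M : ℕ} (xs : List V) → (∀ x → f x ≤ M) → foldr _⊔_ 0 (map f xs) ≤ M
foldr-⊔-least f []       _  = z≤n
foldr-⊔-least f (x ∷ xs) f≤ = ⊔-lub (f≤ x) (foldr-⊔-least f xs f≤)

foldr-⊔-attained : {V : Set} (f : V → ℕ) (xs : List V) →
                   foldr _⊔_ 0 (map f xs) ≡ 0 ⊎ ∃ λ x → f x ≡ foldr _⊔_ 0 (map f xs)
foldr-⊔-attained f []       = inj₁ refl
foldr-⊔-attained f (x ∷ xs) with ⊔-sel (f x) (foldr _⊔_ 0 (map f xs))
... | inj₁ eq = inj₂ (x , sym eq)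
... | inj₂ eq with foldr-⊔-attained f xs
...   | inj₁ z        = inj₁ (trans eq z)
...   | inj₂ (y , fy) = inj₂ (y , trans fy (sym eq))

module Distance {n : ℕ} (G : Graph n) (d : Fin n → Fin n → ℕ) (isd : IsDistance G d) where

  Adj-sym : ∀ {u v} → Adj G u v → Adj G v u
  Adj-sym {u} {v} e = trans (Graph.sym G v u) e

  _⊕_ : ∀ {u v w m l} → Walk G u v m → Walk G v w l → Walk G u w (m + l)
  here     ⊕ W = W
  step e V ⊕ W = step e (V ⊕ W)

  walk-reverse : ∀ {u v m} → Walk G u v m → Walk G v u m
  walk-reverse here = here
  walk-reverse {u} {v} {suc m} (step e W) =
    subst (Walk G v u) (+-comm m 1) (walk-reverse W ⊕ step (Adj-sym e) here)

  walk-split : ∀ {u v} m {l} → Walk G u v (m + l) → ∃ λ w → Walk G u w m × Walk G w v l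
  walk-split zero    W          = _ , here , W
  walk-split (suc m) (step e W) with walk-split m W
  ... | w , W₁ , W₂ = w , step e W₁ , W₂

  geodesic : ∀ u v → Walk G u v (d u v)
  geodesic u v = proj₁ (isd u v)

  d≤ : ∀ {u v m} → Walk G u v m → d u v ≤ m
  d≤ {u} {v} {m} W = proj₂ (isd u v) m W

  d-adj : ∀ {u v} → Adj G u v → d u v ≤ 1
  d-adj e = d≤ (step e here)

  d-refl : ∀ u → d u u ≡ 0
  d-refl u = n≤0⇒n≡0 (d≤ here)

  d-sym : ∀ u v → d u v ≡ d v u
  d-sym u v = ≤-antisym (d≤ (walk-reverse (geodesic v u))) (d≤ (walk-reverse (geodesic u v)))

  d-triangle : ∀ u v w → d u w ≤ d u v + d v w
  d-triangle u v w = d≤ (geodesic u v ⊕ geodesic v w)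

  d≤0⇒≡ : ∀ {u v} → d u v ≤ 0 → u ≡ v
  d≤0⇒≡ {u} {v} p with d u v | geodesic u v
  ... | zero | here = refl

  d≤1⇒Adj : ∀ {u v} → u ≢ v → d u v ≤ 1 → Adj G u v
  d≤1⇒Adj {u} {v} u≢v p with d u v | geodesic u v
  ... | zero        | here          = contradiction refl u≢v
  ... | suc zero    | step e here   = e
  d≤1⇒Adj _ (s≤s ()) | suc (suc _) | _

  d≤ecc : ∀ u v → d u v ≤ ecc d v
  d≤ecc u v = foldr-⊔-upper (λ u → d u v) (∈-allFin u)

  d≤eccˡ : ∀ u v → d u v ≤ ecc d u
  d≤eccˡ u v = subst (_≤ ecc d u) (d-sym v u) (d≤ecc v u)

  ecc≤ : ∀ {v M} → (∀ u → d u v ≤ M) → ecc d v ≤ M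
  ecc≤ {v} = foldr-⊔-least (λ u → d u v) (allFin n)

  ecc-attained : ∀ v → ∃ λ u → d u v ≡ ecc d v
  ecc-attained v with foldr-⊔-attained (λ u → d u v) (allFin n)
  -- The default 0 of the maximum is the distance from `v` to itself.
  ... | inj₁ z = v , trans (d-refl v) (sym z)
  ... | inj₂ w = w

  -- Dropping the last vertex of one walk and the first of another yields the lists `A` and `B`
  -- around the middle edge in `Extremal`.
  init tail : ∀ {u v m} → Walk G u v m → List (Fin n)
  init here             = []
  init (step {u} _ W)   = u ∷ init W
  tail here             = []
  tail (step {w = w} _ W) = w ∷ tail W

  length-init : ∀ {u v m} (W : Walk G u v m) → length (init W) ≡ m
  length-init here       = refl
  length-init (step _ W) = cong suc (length-init W)

  length-tail : ∀ {u v m} (W : Walk G u v m) → length (tail W) ≡ m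
  length-tail here       = refl
  length-tail (step _ W) = cong suc (length-tail W)

  vertices-⊕ : ∀ {u a b v m l} (V : Walk G u a m) (e : Adj G a b) (W : Walk G b v l) →
               u ∷ tail (V ⊕ step e W) ≡ init V ++ a ∷ b ∷ tail W
  vertices-⊕ here        e W = refl
  vertices-⊕ (step _ V)  e W = cong (_ ∷_) (vertices-⊕ V e W)

  vertices-linked : ∀ {u v m} (W : Walk G u v m) → Linked (Adj G) (u ∷ tail W)
  vertices-linked here       = [-]
  vertices-linked (step e W) = e ∷ vertices-linked W

  tail-closer : ∀ {u v m} (W : Walk G u v m) {z} → z ∈ tail W → d z v < m
  tail-closer (step e W) (here refl) = s≤s (d≤ W)
  tail-closer (step e W) (there z∈)  = m≤n⇒m≤1+n (tail-closer W z∈)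

  -- On a shortest walk every later vertex is strictly closer to the end than the start is, and the
  -- remaining walk is again shortest.
  vertices-unique : ∀ {u v m} (W : Walk G u v m) → m ≤ d u v → Unique (u ∷ tail W)
  vertices-unique here _ = [] ∷ []
  vertices-unique {u} {v} {suc m} W@(step {w = w} e W′) m≤d =
    All.tabulate (λ { z∈ refl → <⇒≱ (tail-closer W z∈) m≤d })
    ∷ vertices-unique W′ (s≤s⁻¹ (≤-trans m≤d (d≤ (step e (geodesic w v)))))

  -- Each step changes the distance to `c` by at most 1, so a vertex with t steps left is at
  -- distance at least j + t from `c`.
  Σ-init-lower : ∀ {u a m} c j (W : Walk G u a m) → j + m ≤ d u c → rise j m ≤ Σ[ init W ] (ecc d)
  Σ-init-lower c j here _ = z≤n
  Σ-init-lower {u} {m = suc m} c j (step {w = w} e W) far =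
    +-mono-≤ (≤-trans far (d≤eccˡ u c))
             (Σ-init-lower c j W (s≤s⁻¹ (≤-trans (subst (_≤ d u c) (+-suc j m) far) (d≤ (step e (geodesic w c))))))

  -- Mirror image: after t steps only m - t remain to the far end `v`, so the vertex reached is at
  -- distance at least j + t from `c`.
  Σ-tail-lower : ∀ {b v m} c j (W : Walk G b v m) → j + m ≤ d c v → rise j m ≤ Σ[ tail W ] (ecc d)
  Σ-tail-lower c j here _ = z≤n
  Σ-tail-lower {v = v} {suc m} c j (step {w = w} e W) far =
    subst (_≤ ecc d w + Σ[ tail W ] (ecc d)) (sym (rise-head j m))
      (+-mono-≤ (≤-trans (+-cancelʳ-≤ m (suc j) (d c w) (≤-trans far′ (≤-trans (d-triangle c w v) (+-monoʳ-≤ (d c w) (d≤ W))))) (d≤ecc c w))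
                (Σ-tail-lower c (suc j) W far′))
    where
    far′ : suc j + m ≤ d c v
    far′ = subst (_≤ d c v) (+-suc j m) far

  Σ-split : ∀ {P} (f : Fin n → ℕ) → Unique P → Σ[ allFin n ] f ≡ Σ[ P ] f + Σ[ off P ] f
  Σ-split {P} f uP = trans (sum-↭ (map⁺ f (allFin↭ uP))) (Σ-++ f P (off P))

  n-split : ∀ {P : List (Fin n)} → Unique P → n ≡ length P + length (off P)
  n-split {P} uP = trans (sym (length-tabulate {n = n} (λ x → x))) (trans (↭-length (allFin↭ uP)) (length-++ P))

-- Trees

module Tree {n : ℕ} (G : Graph n) (tree : IsTree G) (d : Fin n → Fin n → ℕ) (isd : IsDistance G d) where
  open Distance G d isd

  -- Edges of a tree as bridges

  module Edge {a b : Fin n} (ab : Adj G a b) where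

    -- Adjacency after deletion of the edge between `a` and `b`, in both orientations. `Side c` is
    -- then the component of `c`.
    _~_ : Fin n → Fin n → Set
    x ~ y = Adj G x y × ¬ (x ≡ a × y ≡ b) × ¬ (x ≡ b × y ≡ a)

    ~-sym : ∀ {x y} → x ~ y → y ~ x
    ~-sym (e , p , q) = Adj-sym e , (λ { (y≡ , x≡) → q (x≡ , y≡) }) , (λ { (y≡ , x≡) → p (x≡ , y≡) })

    Side : Fin n → Fin n → Set
    Side c w = Star _~_ w c

    -- A loop-erased path from `a` to `b` without the edge would close up with that edge to a cycle.
    bridge : ¬ Star _~_ a b
    bridge W with loop-erase W
    ... | _ , stop = contradiction (trans (sym ab) (Graph.loopless G a)) λ ()
    ... | _ , cons (_ , p , _) _ stop = p (refl , refl)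
    -- The path has at least three vertices here, as `IsCycle` requires two besides the start.
    ... | _ , P@(cons _ _ (cons _ _ P′)) =
      proj₂ tree a _ (s≤s (nonempty P′) , simple⇒unique P , simple⇒linked proj₁ P (Adj-sym ab))
      where
      nonempty : ∀ {x y l} → SimplePath _~_ x y l → 1 ≤ length l
      nonempty stop         = s≤s z≤n
      nonempty (cons _ _ _) = s≤s z≤n

    ends? : ∀ {x y} → Adj G x y → x ~ y ⊎ (x ≡ a × y ≡ b) ⊎ (x ≡ b × y ≡ a)
    ends? {x} {y} e with x Fin.≟ a | y Fin.≟ b | x Fin.≟ b | y Fin.≟ a
    ... | yes p | yes q | _     | _     = inj₂ (inj₁ (p , q))
    ... | _     | _     | yes p | yes q = inj₂ (inj₂ (p , q))
    ... | no ¬p | _     | no ¬q | _     = inj₁ (e , ¬p ∘ proj₁ , ¬q ∘ proj₁)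
    ... | no ¬p | _     | _     | no ¬q = inj₁ (e , ¬p ∘ proj₁ , ¬q ∘ proj₂)
    ... | _     | no ¬p | no ¬q | _     = inj₁ (e , ¬p ∘ proj₂ , ¬q ∘ proj₁)
    ... | _     | no ¬p | _     | no ¬q = inj₁ (e , ¬p ∘ proj₂ , ¬q ∘ proj₂)

    -- Follow a walk from `w` to `a` up to its first use of the deleted edge: it stands at `a` or
    -- `b` there.
    side : ∀ w → Side a w ⊎ Side b w
    side w = go (proj₂ (proj₁ tree w a))
      where
      go : ∀ {w m} → Walk G w a m → Side a w ⊎ Side b w
      go here       = inj₁ ε
      go (step e W) with ends? e
      ... | inj₂ (inj₁ (refl , _)) = inj₁ ε
      ... | inj₂ (inj₂ (refl , _)) = inj₂ ε
      ... | inj₁ x~y               = [ (λ s → inj₁ (x~y ◅ s)) , (λ s → inj₂ (x~y ◅ s)) ]′ (go W)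

    disjoint : ∀ {w} → Side a w → ¬ Side b w
    disjoint wa wb = bridge (reverse ~-sym wa ◅◅ wb)

    crossing : ∀ {x y} → Side a x → Side b y → Adj G x y → x ≡ a × y ≡ b
    crossing sx sy e with ends? e
    ... | inj₁ x~y               = ⊥-elim (disjoint sx (x~y ◅ sy))
    ... | inj₂ (inj₁ eq)         = eq
    ... | inj₂ (inj₂ (refl , _)) = ⊥-elim (disjoint sx ε)

    -- The walk has to cross the edge. Before that, each step lowers the distance to `a` by at most
    -- 1; after it, at least `d b x` steps remain.
    across-walk : ∀ {w x m} → Side a w → Side b x → Walk G w x m → d w a + suc (d b x) ≤ m
    across-walk sw sx here = ⊥-elim (disjoint sw sx)
    across-walk {x = x} sw sx (step {w = y} e W) with side y
    ... | inj₁ sy = ≤-trans (+-monoˡ-≤ _ (d≤ (step e (geodesic y a)))) (s≤s (across-walk sy sx W))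
    ... | inj₂ sy with crossing sw sy e
    ...   | refl , refl = ≤-trans (+-monoˡ-≤ _ (≤-reflexive (d-refl a))) (s≤s (d≤ W))

    across : ∀ {w x} → Side a w → Side b x → d w a + suc (d b x) ≤ d w x
    across {w} {x} sw sx = across-walk sw sx (geodesic w x)

  -- The deleted edge has `u` as an end, so a path that misses `u` does not use it.
  avoiding : ∀ {u w x v l} (e : Adj G u w) → SimplePath (Adj G) x v l → u ∉ l → Star (Edge._~_ e) x v
  avoiding e stop         u∉ = ε
  avoiding e (cons f _ P) u∉ =
    (f , (λ { (refl , _) → u∉ (here refl) }) , (λ { (_ , refl) → u∉ (there (head∈ P)) }))
    ◅ avoiding e P (u∉ ∘ there)

  -- The first edge is a bridge with `v` on its far side, so `d u v` is at least one more than
  -- `d w v`; induction does the rest.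
  simple-geodesic : ∀ {u v l} → SimplePath (Adj G) u v l → length l ≤ suc (d u v)
  simple-geodesic stop = s≤s z≤n
  simple-geodesic {u} {v} (cons {w = w} e u∉ P) = s≤s (≤-trans (simple-geodesic P)
    (≤-trans (m≤n+m _ (d u u)) (across ε (reverse ~-sym (avoiding e P u∉)))))
    where open Edge e

  path-length : ∀ {Q D} → (∀ x y → d x y ≤ D) → IsPath G Q → length Q ≤ suc D
  path-length {[]}    _  _       = z≤n
  path-length {x ∷ Q} d≤D (un , L) with unique∧linked⇒simple un L
  ... | y , P = ≤-trans (simple-geodesic P) (s≤s (d≤D x y))

  -- Upper bounds from a path and the vertices hanging off its middle edge

  linked-++⁻ʳ : ∀ A {T} → Linked (Adj G) (A ++ T) → Linked (Adj G) T
  linked-++⁻ʳ []          L       = L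
  linked-++⁻ʳ (_ ∷ [])    [-]     = []
  linked-++⁻ʳ (_ ∷ [])    (_ ∷ L) = L
  linked-++⁻ʳ (_ ∷ y ∷ A) (_ ∷ L) = linked-++⁻ʳ (y ∷ A) L

  head-dist : ∀ {x a T} A → Linked (Adj G) (x ∷ A ++ a ∷ T) → d x a ≤ suc (length A)
  head-dist []      (e ∷ _)           = d-adj e
  head-dist {a = a} (y ∷ A) (e ∷ L) =
    ≤-trans (d≤ (step e (geodesic y a))) (s≤s (head-dist A L))

  prefix-dist : ∀ {a T} A → Linked (Adj G) (A ++ a ∷ T) → All (λ z → d z a ≤ length A) A
  prefix-dist []      _ = []
  prefix-dist (x ∷ A) L = head-dist A L ∷ All.map m≤n⇒m≤1+n (prefix-dist A (linked-++⁻ʳ (x ∷ []) L))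

  next-dist : ∀ {b w} c {j} → Adj G b w → d b c ≤ j → d w c ≤ suc j
  next-dist {b} c e p = ≤-trans (d≤ (step (Adj-sym e) (geodesic b c))) (s≤s p)

  suffix-dist : ∀ {b} c {j} B → Linked (Adj G) (b ∷ B) → d b c ≤ j → All (λ z → d z c ≤ j + length B) B
  suffix-dist c         []      _       _ = []
  suffix-dist c {j} (w ∷ B) (e ∷ L) p =
    subst (λ t → All (λ z → d z c ≤ t) (w ∷ B)) (sym (+-suc j (length B)))
      (≤-trans (next-dist c e p) (m≤m+n (suc j) (length B)) ∷ suffix-dist c B L (next-dist c e p))

  Σ-prefix-upper : ∀ {a T} t A → (∀ z j → d z a ≤ j → ecc d z ≤ t + j) →
                   Linked (Adj G) (A ++ a ∷ T) → Σ[ A ] (ecc d) ≤ rise t (length A)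
  Σ-prefix-upper t []      ub _ = z≤n
  Σ-prefix-upper t (x ∷ A) ub L =
    +-mono-≤ (ub x _ (head-dist A L)) (Σ-prefix-upper t A ub (linked-++⁻ʳ (x ∷ []) L))

  Σ-suffix-upper : ∀ {b} c t j B → (∀ z j → d z c ≤ j → ecc d z ≤ t + j) → d b c ≤ j →
                   Linked (Adj G) (b ∷ B) → Σ[ B ] (ecc d) ≤ rise (t + j) (length B)
  Σ-suffix-upper c t j []      ub p _       = z≤n
  Σ-suffix-upper c t j (w ∷ B) ub p (e ∷ L) =
    subst (ecc d w + Σ[ B ] (ecc d) ≤_) (sym (rise-head (t + j) (length B)))
      (+-mono-≤ (subst (ecc d w ≤_) (+-suc t j) (ub w (suc j) (next-dist c e p)))
                (subst (λ h → Σ[ B ] (ecc d) ≤ rise h (length B)) (+-suc t j)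
                  (Σ-suffix-upper c t (suc j) B ub (next-dist c e p) L)))

  module Middle {a b : Fin n} (ab : Adj G a b) where

    Within : ℕ → Fin n → Set
    Within j z = d z a ≤ j ⊎ d z b ≤ j

    -- A route through the middle edge costs at most 1 more than the two distances to that edge.
    within-dist : ∀ {s j y z} → Within s y → Within j z → d y z ≤ suc s + j
    within-dist {s} {j} {y} {z} = go
      where
      same : ∀ c → d y c ≤ s → d z c ≤ j → d y z ≤ suc s + j
      same c p q = m≤n⇒m≤1+n (≤-trans (d-triangle y c z)
        (+-mono-≤ p (≤-trans (≤-reflexive (d-sym c z)) q)))
      other : ∀ {c c′} → Adj G c c′ → d y c ≤ s → d z c′ ≤ j → d y z ≤ suc s + j
      other {c} {c′} e p q = ≤-trans (d-triangle y c z)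
        (≤-trans (+-mono-≤ p (≤-trans (d≤ (step e (geodesic c′ z))) (s≤s (≤-trans (≤-reflexive (d-sym c′ z)) q))))
                 (≤-reflexive (+-suc s j)))
      go : Within s y → Within j z → d y z ≤ suc s + j
      go (inj₁ p) (inj₁ q) = same a p q
      go (inj₂ p) (inj₂ q) = same b p q
      go (inj₁ p) (inj₂ q) = other ab p q
      go (inj₂ p) (inj₁ q) = other (Adj-sym ab) p q

  path-size : ∀ {s a b} {A B : List (Fin n)} → length A ≡ s → length B ≡ s → Unique (A ++ a ∷ b ∷ B) →
              n ≡ 2 * suc s + length (off (A ++ a ∷ b ∷ B))
  path-size {s} {a} {b} {A} {B} lA lB uP = trans (n-split uP) (cong (_+ length (off (A ++ a ∷ b ∷ B))) (begin
    length (A ++ a ∷ b ∷ B)       ≡⟨ length-++ A ⟩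
    length A + (2 + length B)     ≡⟨ cong₂ (λ x y → x + (2 + y)) lA lB ⟩
    s + (2 + s)                   ≡⟨ lemma s ⟩
    2 * suc s                     ∎))
    where
    open ≡-Reasoning
    lemma : ∀ s → s + (2 + s) ≡ 2 * suc s
    lemma = solve-∀

  Ecc-split : ∀ A {a b B} → Unique (A ++ a ∷ b ∷ B) →
              Ecc d ≡ (Σ[ A ] (ecc d) + (ecc d a + (ecc d b + Σ[ B ] (ecc d)))) + Σ[ off (A ++ a ∷ b ∷ B) ] (ecc d)
  Ecc-split A {a} {b} {B} uP =
    trans (Σ-split (ecc d) uP) (cong (_+ Σ[ off (A ++ a ∷ b ∷ B) ] (ecc d)) (Σ-++ (ecc d) A (a ∷ b ∷ B)))

  module DoubleBroom {s : ℕ} {a b : Fin n} {A B : List (Fin n)} (lA : length A ≡ s) (lB : length B ≡ s)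
           (path : IsPath G (A ++ a ∷ b ∷ B)) (pendant : ∀ w → w ∉ A ++ a ∷ b ∷ B → Adj G w a ⊎ Adj G w b)
           (1≤s : 1 ≤ s) where

    ab∷B : Linked (Adj G) (a ∷ b ∷ B)
    ab∷B = linked-++⁻ʳ A (proj₂ path)

    b∷B : Linked (Adj G) (b ∷ B)
    b∷B = linked-++⁻ʳ (a ∷ []) ab∷B

    ab : Adj G a b
    ab with ab∷B
    ... | e ∷ _ = e

    open Middle ab

    at-pendant : ∀ w → w ∉ A ++ a ∷ b ∷ B → Within 1 w
    at-pendant w w∉ = [ inj₁ ∘ d-adj , inj₂ ∘ d-adj ]′ (pendant w w∉)

    within : ∀ z → Within s z
    within z with z ∈? (A ++ a ∷ b ∷ B)
    -- A vertex off the path is at distance at most 1 from the middle edge; `1 ≤ s` turns this into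
    -- at most s.
    ... | no z∉ = [ (λ p → inj₁ (≤-trans p 1≤s)) , (λ p → inj₂ (≤-trans p 1≤s)) ]′ (at-pendant z z∉)
    ... | yes z∈ with ∈-++⁻ A z∈
    ...   | inj₁ z∈A                   = inj₁ (subst (d z a ≤_) lA (All.lookup (prefix-dist A (proj₂ path)) z∈A))
    ...   | inj₂ (here refl)           = inj₁ (subst (_≤ s) (sym (d-refl a)) z≤n)
    ...   | inj₂ (there (here refl))   = inj₂ (subst (_≤ s) (sym (d-refl b)) z≤n)
    ...   | inj₂ (there (there z∈B))   =
      inj₂ (subst (d z b ≤_) lB (All.lookup (suffix-dist b B b∷B (≤-reflexive (d-refl b))) z∈B))

    diameter≤ : ∀ y z → d y z ≤ suc s + s
    diameter≤ y z = within-dist (within y) (within z)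

    within-ecc : ∀ {z j} → Within j z → ecc d z ≤ suc s + j
    within-ecc p = ecc≤ λ y → within-dist (within y) p

    ecc-middle : ∀ {z} → Within 0 z → ecc d z ≤ suc s
    ecc-middle {z} p = subst (ecc d z ≤_) (+-identityʳ (suc s)) (within-ecc p)

    ecc-a : ecc d a ≤ suc s
    ecc-a = ecc-middle (inj₁ (≤-reflexive (d-refl a)))

    ecc-b : ecc d b ≤ suc s
    ecc-b = ecc-middle (inj₂ (≤-reflexive (d-refl b)))

    Ecc-upper : Ecc d ≤ bound s (length (off (A ++ a ∷ b ∷ B)))
    Ecc-upper = ≤-trans (≤-reflexive (Ecc-split A (proj₁ path))) (+-mono-≤
      (+-mono-≤ (subst (λ l → Σ[ A ] (ecc d) ≤ rise (suc s) l) lA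
                  (Σ-prefix-upper (suc s) A (λ _ _ → within-ecc ∘ inj₁) (proj₂ path)))
      (+-mono-≤ ecc-a
      (+-mono-≤ ecc-b
                (subst (Σ[ B ] (ecc d) ≤_) (cong₂ rise (+-identityʳ (suc s)) lB)
                  (Σ-suffix-upper b (suc s) 0 B (λ _ _ → within-ecc ∘ inj₂) (≤-reflexive (d-refl b)) b∷B)))))
      (Σ-upper (All.tabulate λ {w} w∈ →
        subst (ecc d w ≤_) (+-comm (suc s) 1) (within-ecc (at-pendant w (∈off⁻ w∈))))))

  -- The path realising the lower bound

  -- `b` will be the central vertex and `suc s` the radius. In `far`, the middle vertex is the one
  -- on the side of `w`, and a distant vertex on the other side accounts for `suc s`.
  record CentralPath (s : ℕ) : Set where
    field
      a b : Fin n
      A B : List (Fin n)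
      lA : length A ≡ s
      lB : length B ≡ s
      path : IsPath G (A ++ a ∷ b ∷ B)
      ΣA : rise (suc s) s ≤ Σ[ A ] (ecc d)
      ΣB : rise (suc s) s ≤ Σ[ B ] (ecc d)
      far : ∀ w → d w a + suc s ≤ ecc d w ⊎ d w b + suc s ≤ ecc d w

  central-path : ∀ v s → InCenter d v → ecc d v ≡ suc s → CentralPath s
  central-path v s center eccv with ecc-attained v
  ... | p , dpv with subst (Walk G v p) (trans (d-sym v p) (trans dpv eccv)) (geodesic v p)
  -- The radius is positive, so the geodesic to `p` has a first step, which defines `a`.
  ... | step {w = a} va Wp with ecc-attained a
  -- `q` is at distance s or s + 1 from `v`; cutting the geodesic after s steps makes both halves of
  -- the path equally long.
  ... | q , dqa = build (walk-split s (subst (Walk G v q) (sym (m+[n∸m]≡n s≤dvq)) (geodesic v q)))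
    where
    open ≤-Reasoning
    av : Adj G a v
    av = Adj-sym va
    open Edge av

    dvp : d v p ≡ suc s
    dvp = trans (d-sym v p) (trans dpv eccv)

    p-side : Side a p
    p-side with side p
    ... | inj₁ sa = sa
    -- If `p` were on the side of `v`, a geodesic from `a` to `p` would cross to `v` first and have
    -- length at least s + 2.
    ... | inj₂ sv = contradiction (begin
      suc (suc s)           ≡⟨ cong suc dvp ⟨
      suc (d v p)           ≤⟨ m≤n+m _ (d a a) ⟩
      d a a + suc (d v p)   ≤⟨ across ε sv ⟩
      d a p                 ≤⟨ d≤ Wp ⟩
      s                     ∎) (<⇒≱ (n≤1+n (suc s)))

    r≤dqa : suc s ≤ d q a
    r≤dqa = begin
      suc s     ≡⟨ eccv ⟨
      ecc d v   ≤⟨ center a ⟩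
      ecc d a   ≡⟨ dqa ⟨
      d q a     ∎

    q-side : Side v q
    q-side with side q
    ... | inj₂ sv = sv
    ... | inj₁ sa = contradiction (begin
      suc (suc s)           ≡⟨ +-comm 1 (suc s) ⟩
      suc s + 1             ≤⟨ +-mono-≤ r≤dqa (s≤s z≤n) ⟩
      d q a + suc (d v v)   ≤⟨ across sa ε ⟩
      d q v                 ≤⟨ d≤ecc q v ⟩
      ecc d v               ≡⟨ eccv ⟩
      suc s                 ∎) (<⇒≱ ≤-refl)

    s≤dvq : s ≤ d v q
    s≤dvq = s≤s⁻¹ (begin
      suc s         ≤⟨ r≤dqa ⟩
      d q a         ≡⟨ d-sym q a ⟩
      d a q         ≤⟨ d≤ (step av (geodesic v q)) ⟩
      suc (d v q)   ∎)

    s≤dpa : s ≤ d p a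
    s≤dpa = s≤s⁻¹ (begin
      suc s         ≡⟨ dvp ⟨
      d v p         ≤⟨ d≤ (step va (geodesic a p)) ⟩
      suc (d a p)   ≡⟨ cong suc (d-sym a p) ⟩
      suc (d p a)   ∎)

    far-side : ∀ w → d w a + suc s ≤ ecc d w ⊎ d w v + suc s ≤ ecc d w
    far-side w with side w
    ... | inj₁ sa = inj₁ (begin
      d w a + suc s         ≤⟨ +-monoʳ-≤ (d w a) (s≤s s≤dvq) ⟩
      d w a + suc (d v q)   ≤⟨ across sa q-side ⟩
      d w q                 ≤⟨ d≤eccˡ w q ⟩
      ecc d w               ∎)
    ... | inj₂ sv = inj₂ (begin
      d w v + suc s         ≡⟨ +-comm (d w v) (suc s) ⟩
      suc s + d w v         ≡⟨ +-suc s (d w v) ⟨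
      s + suc (d w v)       ≤⟨ +-mono-≤ s≤dpa (s≤s (≤-reflexive (d-sym w v))) ⟩
      d p a + suc (d v w)   ≤⟨ across p-side sv ⟩
      d p w                 ≤⟨ d≤ecc p w ⟩
      ecc d w               ∎)

    build : (∃ λ q′ → Walk G v q′ s × Walk G q′ q (d v q ∸ s)) → CentralPath s
    build (q′ , Wq , W′) = record
      { a = a ; b = v ; A = init Wa ; B = tail Wq
      ; lA = length-init Wa ; lB = length-tail Wq
      ; path = subst Unique vs (vertices-unique W (subst (_≤ d p q′) (sym (+-suc s s)) pq′))
             , subst (Linked (Adj G)) vs (vertices-linked W)
      ; ΣA = Σ-init-lower q′ (suc s) Wa pq′
      ; ΣB = Σ-tail-lower p (suc s) Wq pq′
      ; far = far-side }
      where
      Wa : Walk G p a s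
      Wa = walk-reverse Wp
      W : Walk G p q′ (s + suc s)
      W = Wa ⊕ step av Wq
      vs : p ∷ tail W ≡ init Wa ++ a ∷ v ∷ tail Wq
      vs = vertices-⊕ Wa av Wq
      -- The distance from `p` to `q` is at least 2 s + 1 plus the length of the part cut off after
      -- `q′`, and stopping at `q′` loses at most that length.
      pq′ : suc s + s ≤ d p q′
      pq′ = +-cancelʳ-≤ (d v q ∸ s) (suc s + s) (d p q′) (begin
        suc s + s + (d v q ∸ s)     ≡⟨ +-assoc (suc s) s _ ⟩
        suc s + (s + (d v q ∸ s))   ≡⟨ cong (suc s +_) (m+[n∸m]≡n s≤dvq) ⟩
        suc s + d v q               ≡⟨ +-suc s (d v q) ⟨
        s + suc (d v q)             ≤⟨ +-monoˡ-≤ (suc (d v q)) s≤dpa ⟩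
        d p a + suc (d v q)         ≤⟨ across p-side q-side ⟩
        d p q                       ≤⟨ d-triangle p q′ q ⟩
        d p q′ + d q′ q             ≤⟨ +-monoʳ-≤ (d p q′) (d≤ W′) ⟩
        d p q′ + (d v q ∸ s)        ∎)

  -- The lower bound and its equality case

  module CentralBound {v : Fin n} {s : ℕ} (center : InCenter d v) (eccv : ecc d v ≡ suc s) (C : CentralPath s) where
    open CentralPath C

    P : List (Fin n)
    P = A ++ a ∷ b ∷ B

    radius≤ : ∀ w → suc s ≤ ecc d w
    radius≤ w = subst (_≤ ecc d w) eccv (center w)

    -- Off the path `w` differs from both `a` and `b`, so the distance in `far` is at least 1.
    off-far : ∀ {w} → w ∉ P → suc (suc s) ≤ ecc d w
    off-far {w} w∉ with far w
    ... | inj₁ p = ≤-trans (+-monoˡ-≤ (suc s) (n≢0⇒n>0 λ z → w∉ (∈-++⁺ʳ A (here (d≤0⇒≡ (≤-reflexive z)))))) p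
    ... | inj₂ p = ≤-trans (+-monoˡ-≤ (suc s) (n≢0⇒n>0 λ z → w∉ (∈-++⁺ʳ A (there (here (d≤0⇒≡ (≤-reflexive z))))))) p

    all-off-far : All (λ w → suc (suc s) ≤ ecc d w) (off P)
    all-off-far = All.tabulate (off-far ∘ ∈off⁻)

    ΣP-lower : rise (suc s) s + (suc s + (suc s + rise (suc s) s)) ≤ Σ[ A ] (ecc d) + (ecc d a + (ecc d b + Σ[ B ] (ecc d)))
    ΣP-lower = +-mono-≤ ΣA (+-mono-≤ (radius≤ a) (+-mono-≤ (radius≤ b) ΣB))

    Ecc-lower : bound s (length (off P)) ≤ Ecc d
    Ecc-lower = ≤-trans (+-mono-≤ ΣP-lower (Σ-lower all-off-far)) (≤-reflexive (sym (Ecc-split A (proj₁ path))))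

    -- Equality leaves eccentricity exactly s + 2 for each vertex off the path, and `far` then
    -- leaves distance 1 to `a` or `b`. The diameter bound for this shape shows that no path is
    -- longer.
    tight⇒extremal : 1 ≤ s → Ecc d ≤ bound s (length (off P)) → Extremal G (suc s)
    tight⇒extremal 1≤s tight =
      A , a , b , B , cong suc lA , trans lB (sym lA) , path , longest , pendant
      where
      off-tight : All (λ w → ecc d w ≤ suc (suc s)) (off P)
      off-tight = Σ-tight all-off-far (+-cancelˡ-≤ _ _ _
        (≤-trans (+-monoˡ-≤ _ ΣP-lower) (≤-trans (≤-reflexive (sym (Ecc-split A (proj₁ path)))) tight)))

      pendant : ∀ w → w ∉ P → Adj G w a ⊎ Adj G w b
      pendant w w∉ with far w | All.lookup off-tight (∈off⁺ w∉)
      ... | inj₁ p | q = inj₁ (d≤1⇒Adj (λ { refl → w∉ (∈-++⁺ʳ A (here refl)) })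
                                       (+-cancelʳ-≤ (suc s) (d w a) 1 (≤-trans p q)))
      ... | inj₂ p | q = inj₂ (d≤1⇒Adj (λ { refl → w∉ (∈-++⁺ʳ A (there (here refl))) })
                                       (+-cancelʳ-≤ (suc s) (d w b) 1 (≤-trans p q)))

      open DoubleBroom lA lB path pendant 1≤s using (diameter≤)

      longest : ∀ Q → IsPath G Q → length Q ≤ length P
      longest Q pQ = ≤-trans (path-length diameter≤ pQ) (≤-reflexive (begin
        suc (suc s + s)             ≡⟨ +-comm (suc (suc s)) s ⟩
        s + suc (suc s)             ≡⟨ cong₂ (λ x y → x + suc (suc y)) lA lB ⟨
        length A + length (a ∷ b ∷ B) ≡⟨ length-++ A ⟨
        length P                    ∎))
        where open ≡-Reasoning

  -- The radius is at most `ecc d a`, hence at most s + 1. Conversely, the path is a geodesic with 2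
  -- (s + 1) vertices, while distances are at most twice the radius.
  extremal⇒tight : ∀ {v s} → InCenter d v → 1 ≤ s → Extremal G (suc s) →
                   ecc d v ≡ suc s × ∃ λ c → n ≡ 2 * suc s + c × Ecc d ≤ bound s c
  extremal⇒tight {v} {s} center 1≤s (A , a , b , B , lA , lB , path , _ , pendant) =
    ≤-antisym (≤-trans (center a) ecc-a) (halve 2x≤) ,
    length (off P) , path-size lA′ lB′ (proj₁ path) , Ecc-upper
    where
    P : List (Fin n)
    P = A ++ a ∷ b ∷ B
    lA′ : length A ≡ s
    lA′ = suc-injective lA
    lB′ : length B ≡ s
    lB′ = trans lB lA′
    open DoubleBroom lA′ lB′ path pendant 1≤s

    diameter≤2r : ∀ x y → d x y ≤ 2 * ecc d v
    diameter≤2r x y = ≤-trans (d-triangle x v y)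
      (+-mono-≤ (d≤ecc x v) (≤-trans (d≤eccˡ v y) (m≤m+n _ 0)))

    2x≤ : 2 * suc s ≤ suc (2 * ecc d v)
    2x≤ = ≤-trans (≤-reflexive (begin
      2 * suc s                     ≡⟨ lemma s ⟨
      s + suc (suc s)               ≡⟨ cong₂ (λ x y → x + suc (suc y)) lA′ lB′ ⟨
      length A + length (a ∷ b ∷ B) ≡⟨ length-++ A ⟨
      length P                      ∎)) (path-length diameter≤2r path)
      where
      open ≡-Reasoning
      lemma : ∀ s → s + suc (suc s) ≡ 2 * suc s
      lemma = solve-∀

    -- By parity the extra 1 disappears on halving.
    halve : ∀ {x y} → 2 * x ≤ suc (2 * y) → x ≤ y
    halve {x} {y} p = s≤s⁻¹ (*-cancelˡ-< 2 x (suc y) (≤-trans (s≤s p) (≤-reflexive (lemma y))))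
      where
      lemma : ∀ y → suc (suc (2 * y)) ≡ 2 * suc y
      lemma = solve-∀

-- The arithmetic of r + n / r

-- The two equal halves of the path supply the factor 2 for `rise-double`. With r = s + 1 and n = 2
-- r + c this evaluates `bound` as r² + n r + n - 3 r, with 3 r moved to the left to avoid truncated
-- subtraction.
bound-value : ∀ s c → bound s c + 3 * suc s ≡ suc s * suc s + (2 * suc s + c) * suc s + (2 * suc s + c)
bound-value s c = begin
  bound s c + 3 * suc s
    ≡⟨ collect s c (rise (suc s) s) ⟩
  2 * rise (suc s) s + (2 * suc s + c * suc (suc s) + 3 * suc s)
    ≡⟨ cong (_+ (2 * suc s + c * suc (suc s) + 3 * suc s)) (rise-double (suc s) s) ⟩
  s * (2 * suc s + suc s) + (2 * suc s + c * suc (suc s) + 3 * suc s)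
    ≡⟨ expand s c ⟩
  suc s * suc s + (2 * suc s + c) * suc s + (2 * suc s + c) ∎
  where
  open ≡-Reasoning
  collect : ∀ s c x → ((x + (suc s + (suc s + x))) + c * suc (suc s)) + 3 * suc s ≡ 2 * x + (2 * suc s + c * suc (suc s) + 3 * suc s)
  collect = solve-∀
  expand : ∀ s c → s * (2 * suc s + suc s) + (2 * suc s + c * suc (suc s) + 3 * suc s) ≡ suc s * suc s + (2 * suc s + c) * suc s + (2 * suc s + c)
  expand = solve-∀

-- With φ = bound s c and N = n + 2k − 3, the claim φ / r ≥ N + e / m becomes r (N m + e) ≤ φ m;
-- the difference of the two sides is v − u.
clear-denominators : ∀ n k N r m e φ u v → N + 3 ≡ n + 2 * k → φ + 3 * r ≡ r * r + n * r + n →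
  (r * r + n * r + n) * m + u ≡ r * ((n + 2 * k) * m + e) + v →
  φ * m + u ≡ r * (N * m + e) + v
clear-denominators n k N r m e φ u v N+3 φ+3r eq = +-cancelʳ-≡ (3 * r * m) _ _ (begin
  φ * m + u + 3 * r * m                     ≡⟨ left φ m u r ⟩
  (φ + 3 * r) * m + u                       ≡⟨ cong (λ x → x * m + u) φ+3r ⟩
  (r * r + n * r + n) * m + u               ≡⟨ eq ⟩
  r * ((n + 2 * k) * m + e) + v             ≡⟨ cong (λ x → r * (x * m + e) + v) N+3 ⟨
  r * ((N + 3) * m + e) + v                 ≡⟨ right r N m e v ⟩
  r * (N * m + e) + v + 3 * r * m           ∎)
  where
  open ≡-Reasoning
  left : ∀ φ m u r → φ * m + u + 3 * r * m ≡ (φ + 3 * r) * m + u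
  left = solve-∀
  right : ∀ r N m e v → r * ((N + 3) * m + e) + v ≡ r * (N * m + e) + v + 3 * r * m
  right = solve-∀

Optimum : (L U : ℕ) → Set → Set
Optimum L U P = L ≤ U × (L ≡ U → P) × (P → L ≡ U)

-- The slack U - L equals v - u, so the inequality and its equality case can be read off from the
-- two correction terms.
optimum : ∀ {L U u v} {P : Set} → U + u ≡ L + v → u ≤ v → (u ≡ v → P) → (P → u ≡ v) → Optimum L U P
optimum {L} {U} {u} {v} eq u≤v to from =
  +-cancelʳ-≤ u L U (≤-trans (+-monoʳ-≤ L u≤v) (≤-reflexive (sym eq))) ,
  (λ { refl → to (+-cancelˡ-≡ L u v eq) }) ,
  (λ p → sym (+-cancelʳ-≡ u U L (trans eq (cong (L +_) (sym (from p))))))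

module _ {N r φ : ℕ} where

  -- The difference is t (k t − i) for r = k + t, and t (k t + i) for r = k − t.
  optimum₁ : ∀ {n k i} → n ≡ k * k + i → N + 3 ≡ n + 2 * k → φ + 3 * r ≡ r * r + n * r + n → 1 ≤ k → i ≤ k →
             Optimum (r * (N * k + i)) (φ * k) (AllowedX k i r)
  optimum₁ {n} {k} {i} refl N+3 φ+3r 1≤k i≤k with ≤-total k r
  ... | inj₁ k≤r with m≤n⇒∃[o]m+o≡n k≤r
  ...   | t , refl = optimum (clear-denominators (k * k + i) k N r k i φ (t * i) (k * t * t) N+3 φ+3r (identity k t i))
                             (u≤v t) (to t) (from t)
    where
    identity : ∀ k t i → ((k + t) * (k + t) + (k * k + i) * (k + t) + (k * k + i)) * k + t * i ≡ (k + t) * ((k * k + i + 2 * k) * k + i) + k * t * t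
    identity = solve-∀
    u≤v : ∀ t → t * i ≤ k * t * t
    u≤v zero    = z≤n
    u≤v (suc t) = ≤-trans (*-monoʳ-≤ (suc t) i≤k)
      (≤-trans (≤-reflexive (*-comm (suc t) k)) (m≤m*n (k * suc t) (suc t)))
    to : ∀ t → t * i ≡ k * t * t → AllowedX k i (k + t)
    to zero    _  = inj₁ (+-identityʳ k , i≤k)
    to (suc t) eq with *-cancelʳ-≡ i (k * suc t) (suc t) (trans (*-comm i (suc t)) eq)
    -- This is the tie i = k, where the radius k + 1 is as good as k. For larger t, i = k t would be
    -- at least 2 k and so exceed k.
    to (suc zero)    eq | i≡ = inj₂ (+-comm k 1 , ≤-reflexive (sym (trans i≡ (*-identityʳ k))))
    to (suc (suc t)) eq | i≡ = contradiction (≤-trans (≤-reflexive (sym i≡)) i≤k)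
      (<⇒≱ (≤-trans (+-monoˡ-≤ k 1≤k) (≤-trans (m≤m+n (k + k) (t * k)) (≤-reflexive (lemma k t)))))
      where
      lemma : ∀ k t → k + k + t * k ≡ k * suc (suc t)
      lemma = solve-∀
    from : ∀ t → AllowedX k i (k + t) → t * i ≡ k * t * t
    from t (inj₁ (k+t≡k , _)) with +-cancelˡ-≡ k t 0 (trans k+t≡k (sym (+-identityʳ k)))
    ... | refl = sym (*-zeroʳ (k * 0))
    from t (inj₂ (k+t≡ , k≤i)) with +-cancelˡ-≡ k t 1 (trans k+t≡ (+-comm 1 k)) | ≤-antisym i≤k k≤i
    ... | refl | refl = lemma k
      where
      lemma : ∀ k → 1 * k ≡ k * 1 * 1
      lemma = solve-∀
  optimum₁ {n} {k} {i} refl N+3 φ+3r 1≤k i≤k | inj₂ r≤k with m≤n⇒∃[o]m+o≡n r≤k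
  ...   | t , refl = optimum (clear-denominators (k * k + i) k N r k i φ 0 ((r + t) * t * t + t * i) N+3 φ+3r (identity r t i))
                             z≤n (to t i≤k) (from t)
    where
    identity : ∀ r t i → (r * r + ((r + t) * (r + t) + i) * r + ((r + t) * (r + t) + i)) * (r + t) + 0 ≡ r * (((r + t) * (r + t) + i + 2 * (r + t)) * (r + t) + i) + ((r + t) * t * t + t * i)
    identity = solve-∀
    to : ∀ t → i ≤ r + t → 0 ≡ (r + t) * t * t + t * i → AllowedX (r + t) i r
    to zero    i≤ _  = inj₁ (sym (+-identityʳ r) , i≤)
    to (suc t) _  eq = contradiction eq (<⇒≢ (≤-trans
      (*-mono-≤ (*-mono-≤ (m≤n+m 1 (r + t)) (s≤s {n = t} z≤n)) (s≤s {n = t} z≤n))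
      (≤-trans (≤-reflexive (cong (λ x → x * suc t * suc t) (lemma r t))) (m≤m+n _ _))))
      where
      lemma : ∀ r t → r + t + 1 ≡ r + suc t
      lemma = solve-∀
    from : ∀ t → AllowedX (r + t) i r → 0 ≡ (r + t) * t * t + t * i
    from t (inj₁ (r≡r+t , _)) with +-cancelˡ-≡ r t 0 (trans (sym r≡r+t) (sym (+-identityʳ r)))
    ... | refl = sym (trans (+-identityʳ _) (*-zeroʳ ((r + 0) * 0)))
    from t (inj₂ (r≡ , _)) = contradiction (m≤m+n r t) (<⇒≱ (≤-reflexive (sym r≡)))

  -- With m = k + 1 and j = 2k + 1 − i, the difference is t (m t + j) for r = m + t, and t (m t − j) for r = m − t.
  optimum₂ : ∀ {n k i} → n ≡ k * k + i → N + 3 ≡ n + 2 * k → φ + 3 * r ≡ r * r + n * r + n → i ≤ 2 * k → suc k ≤ i →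
             Optimum (r * (N * suc k + suc i)) (φ * suc k) (AllowedX k i r)
  optimum₂ {k = k} n≡ N+3 φ+3r i≤2k k<i with m≤n⇒∃[o]m+o≡n k<i | <-≤-connex k r
  optimum₂ {k = k} refl N+3 φ+3r i≤2k k<i | e , refl | inj₁ k<r
    with m≤n⇒∃[o]m+o≡n k<r | m≤n⇒∃[o]m+o≡n (+-cancelˡ-≤ (suc k) e k (≤-trans i≤2k (≤-trans (n≤1+n _) (≤-reflexive (cong (λ x → suc (k + x)) (+-identityʳ k))))))
  -- Here i = k + 1 + e, k = e + j and r = k + 1 + t, so that j = 2 k + 1 - i.
  ... | t , refl | j , refl =
    optimum (clear-denominators (k * k + (suc k + e)) k N r (suc k) (suc (suc k + e)) φ 0 (suc (e + j) * t * t + j * t) N+3 φ+3r (identity e j t)) z≤n (to t) (from t)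
    where
    identity : ∀ e j t → ((suc (e + j) + t) * (suc (e + j) + t) + ((e + j) * (e + j) + (suc (e + j) + e)) * (suc (e + j) + t) + ((e + j) * (e + j) + (suc (e + j) + e))) * suc (e + j) + 0
      ≡ (suc (e + j) + t) * (((e + j) * (e + j) + (suc (e + j) + e) + 2 * (e + j)) * suc (e + j) + suc (suc (e + j) + e)) + (suc (e + j) * t * t + j * t)
    identity = solve-∀
    to : ∀ t → 0 ≡ suc (e + j) * t * t + j * t → AllowedX (e + j) (suc (e + j) + e) (suc (e + j) + t)
    to zero    _ = inj₂ (+-identityʳ _ , ≤-trans (n≤1+n _) k<i)
    to (suc t) ()
    from : ∀ t → AllowedX (e + j) (suc (e + j) + e) (suc (e + j) + t) → 0 ≡ suc (e + j) * t * t + j * t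
    from t (inj₁ (_ , i≤k)) = contradiction i≤k (<⇒≱ k<i)
    from t (inj₂ (eq , _)) with +-cancelˡ-≡ (suc (e + j)) t 0 (trans eq (sym (+-identityʳ _)))
    ... | refl = sym (cong₂ _+_ (*-zeroʳ (suc (e + j) * 0)) (*-zeroʳ j))
  optimum₂ {k = k} refl N+3 φ+3r i≤2k k<i | e , refl | inj₂ r≤k with m≤n⇒∃[o]m+o≡n r≤k
  -- Now k = r + t, so r falls short of m = k + 1 by t + 1, and m (t + 1) - j = m t + e + 1 is
  -- positive: equality cannot occur.
  ... | t , refl =
    optimum (clear-denominators (k * k + (suc k + e)) k N r (suc k) (suc (suc k + e)) φ 0 (suc t * (suc (r + t) * t + suc e)) N+3 φ+3r (identity r t e)) z≤n to from
    where
    identity : ∀ r t e → (r * r + ((r + t) * (r + t) + (suc (r + t) + e)) * r + ((r + t) * (r + t) + (suc (r + t) + e))) * suc (r + t) + 0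
      ≡ r * (((r + t) * (r + t) + (suc (r + t) + e) + 2 * (r + t)) * suc (r + t) + suc (suc (r + t) + e)) + suc t * (suc (r + t) * t + suc e)
    identity = solve-∀
    to : 0 ≡ suc t * (suc (r + t) * t + suc e) → AllowedX (r + t) (suc (r + t) + e) r
    to eq = contradiction eq (<⇒≢ (*-mono-≤ (s≤s {n = t} z≤n) (≤-trans (s≤s z≤n) (m≤n+m (suc e) (suc (r + t) * t)))))
    from : AllowedX (r + t) (suc (r + t) + e) r → 0 ≡ suc t * (suc (r + t) * t + suc e)
    from (inj₁ (_ , i≤k)) = contradiction i≤k (<⇒≱ k<i)
    from (inj₂ (eq , _))  = contradiction r≤k (<⇒≱ (≤-reflexive (sym eq)))

-- Small values of k and assembly of the theorem

k≥1 : ∀ {n k i} → 2 ≤ n → i ≤ 2 * k → n ≡ k * k + i → 1 ≤ k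
k≥1 {k = zero}  () z≤n refl
k≥1 {k = suc k} _ _ _ = s≤s z≤n

-- For k = 1 there are at most 3 vertices. With k at least 2 every allowed x is at least 2, which
-- gives the `1 ≤ s` of the equality case.
k≥2 : ∀ {n k i} → 4 ≤ n → i ≤ 2 * k → n ≡ k * k + i → 2 ≤ k
k≥2 {k = zero}        ()  z≤n  refl
k≥2 {k = suc zero}    4≤n i≤2  refl = contradiction (≤-trans 4≤n (s≤s i≤2)) λ { (s≤s (s≤s (s≤s ()))) }
k≥2 {k = suc (suc k)} _   _    _    = s≤s (s≤s z≤n)

allowed≥k : ∀ {k i x} → AllowedX k i x → k ≤ x
allowed≥k (inj₁ (refl , _)) = ≤-refl
allowed≥k (inj₂ (refl , _)) = n≤1+n _

another : ∀ {n} → 2 ≤ n → (v : Fin n) → ∃ λ w → w ≢ v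
another (s≤s (s≤s _)) zero    = suc zero , λ ()
another (s≤s (s≤s _)) (suc v) = zero , λ ()

theorem2p2 : (n : ℕ) (G : Graph n) → IsTree G → 2 ≤ n →
    (k i : ℕ) → i ≤ 2 * k → n ≡ k * k + i →
    (d : Fin n → Fin n → ℕ) → IsDistance G d →
    (v : Fin n) → InCenter d v →
    ((i ≤ k →
    ecc d v * ((n + 2 * k ∸ 3) * k + i) ≤ Ecc d * k
    × (4 ≤ n →
    (ecc d v * ((n + 2 * k ∸ 3) * k + i) ≡ Ecc d * k)
    ⇔ (∃ λ x → AllowedX k i x × Extremal G x)))
    × (suc k ≤ i →
    ecc d v * ((n + 2 * k ∸ 3) * suc k + suc i) ≤ Ecc d * suc k
    × (4 ≤ n →
    (ecc d v * ((n + 2 * k ∸ 3) * suc k + suc i) ≡ Ecc d * suc k)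
    ⇔ (∃ λ x → AllowedX k i x × Extremal G x))))
theorem2p2 n G tree 2≤n k i i≤2k n≡ d isd v center = conclude (ecc d v) refl
  where
  open Distance G d isd
  open Tree G tree d isd

  1≤k : 1 ≤ k
  1≤k = k≥1 2≤n i≤2k n≡

  N+3 : n + 2 * k ∸ 3 + 3 ≡ n + 2 * k
  -- Both n and 2 k are at least 2, so subtracting 3 does not truncate.
  N+3 = m∸n+n≡m (≤-trans (n≤1+n 3) (+-mono-≤ 2≤n (*-monoʳ-≤ 2 1≤k)))

  Claim : ℕ → ℕ → ℕ → Set
  Claim r X M = r * X ≤ Ecc d * M × (4 ≤ n → (r * X ≡ Ecc d * M) ⇔ (∃ λ x → AllowedX k i x × Extremal G x))

  conclude : ∀ r → ecc d v ≡ r →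
    (i ≤ k → Claim (ecc d v) ((n + 2 * k ∸ 3) * k + i) k) ×
    (suc k ≤ i → Claim (ecc d v) ((n + 2 * k ∸ 3) * suc k + suc i) (suc k))
  -- Radius 0 would make every vertex equal to `v`.
  conclude zero eccv with another 2≤n v
  ... | w , w≢v = contradiction (d≤0⇒≡ (≤-trans (d≤ecc w v) (≤-reflexive eccv))) w≢v
  conclude (suc s) eccv =
    (λ i≤k → claim 1≤k (optimum₁ n≡ N+3 φ+3r 1≤k i≤k)) ,
    (λ k<i → claim (s≤s z≤n) (optimum₂ n≡ N+3 φ+3r i≤2k k<i))
    where
    C : CentralPath s
    C = central-path v s center eccv
    open CentralPath C using (lA; lB; path)
    open CentralBound center eccv C using (P; Ecc-lower; tight⇒extremal)

    c : ℕ
    c = length (off P)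

    size : n ≡ 2 * suc s + c
    size = path-size lA lB (proj₁ path)

    φ+3r : bound s c + 3 * suc s ≡ suc s * suc s + n * suc s + n
    φ+3r = trans (bound-value s c) (cong (λ x → suc s * suc s + x * suc s + x) (sym size))

    allowed⇒1≤ : 4 ≤ n → ∀ {s} → AllowedX k i (suc s) → 1 ≤ s
    allowed⇒1≤ 4≤n al = s≤s⁻¹ (≤-trans (k≥2 4≤n i≤2k n≡) (allowed≥k al))

    -- The given path need not be the one in `C`, but the radius fixes its length and n then fixes
    -- the number of vertices off it, so both yield the same value of `bound`.
    extremal⇒Ecc≡ : ∀ {x} → 4 ≤ n → AllowedX k i x → Extremal G x → suc s ≡ x × Ecc d ≡ bound s c
    extremal⇒Ecc≡ {zero}  _   _  (_ , _ , _ , _ , () , _)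
    extremal⇒Ecc≡ {suc s′} 4≤n al ext with extremal⇒tight center (allowed⇒1≤ 4≤n al) ext
    ... | eccv′ , c′ , size′ , upper with suc-injective (trans (sym eccv) eccv′)
    ... | refl = refl , ≤-antisym (subst (λ c → Ecc d ≤ bound s c)
                   (+-cancelˡ-≡ (2 * suc s) c′ c (trans (sym size′) size)) upper) Ecc-lower

    -- In the chain r X ≤ `bound s c` M ≤ `Ecc d` M, equality of the ends forces equality in both
    -- links: the first makes the radius allowed, the second makes the tree extremal.
    claim : ∀ {X M} → 1 ≤ M → Optimum (suc s * X) (bound s c * M) (AllowedX k i (suc s)) → Claim (ecc d v) X M
    claim {X} {M@(suc _)} _ (below , equal⇒allowed , allowed⇒equal) =
      subst (λ r → Claim r X M) (sym eccv)
        (≤-trans below (*-monoˡ-≤ M Ecc-lower) , λ 4≤n → mk⇔ (to 4≤n) (from 4≤n))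
      where
      to : 4 ≤ n → suc s * X ≡ Ecc d * M → ∃ λ x → AllowedX k i x × Extremal G x
      to 4≤n eq = suc s , al , tight⇒extremal (allowed⇒1≤ 4≤n al) (*-cancelʳ-≤ (Ecc d) (bound s c) M tight)
        where
        tight : Ecc d * M ≤ bound s c * M
        tight = subst (_≤ bound s c * M) eq below
        al : AllowedX k i (suc s)
        al = equal⇒allowed (≤-antisym below (≤-trans (*-monoˡ-≤ M Ecc-lower) (≤-reflexive (sym eq))))
      from : 4 ≤ n → (∃ λ x → AllowedX k i x × Extremal G x) → suc s * X ≡ Ecc d * M
      from 4≤n (x , al , ext) with extremal⇒Ecc≡ 4≤n al ext
      ... | refl , Ecc≡ = trans (allowed⇒equal al) (cong (_* M) (sym Ecc≡))
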